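{- For every $m\in\mathbb{N}$ there exist a graph $G$ with $\mathrm{tw}(G)\le m$, a 2-coloring $c:V(G)\to\{\mathbf{r},\mathbf{b}\}$, and a non-piercing family $\mathcal{H}$ of subgraphs of $G$ such that every primal support $Q$ for $(G,\mathcal{H})$ satisfies $\mathrm{tw}(Q)\ge \frac{2^{\lfloor m/2\rfloor}}{\sqrt{m}}$.
   Context: Subgraphs are identified with their vertex sets (induced subgraphs). A family $\mathcal{H}$ of connected subgraphs of $G$ is non-piercing if for all $H,H'\in\mathcal{H}$ the subgraph of $G$ induced on $V(H)\setminus V(H')$ is connected. With $\mathbf{b}(V)=c^{ -1}(\mathbf{b})$, a primal support for $(G,\mathcal{H})$ is a graph $Q$ on vertex set $\mathbf{b}(V)$ such that for every $H\in\mathcal{H}$, $V(H)\cap \mathbf{b}(V)$ induces a connected subgraph of $Q$. $\mathrm{tw}$ denotes treewidth. -}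

module Defs where

open import Level using (0ℓ)
open import Data.Nat using (ℕ; suc; _≤_)
open import Data.Fin using (Fin)
open import Data.List using (List; []; _∷_; _++_; [_]; length)
open import Data.List.Membership.Propositional using (_∈_)
open import Data.List.Relation.Unary.Unique.Propositional using (Unique)
open import Data.Product using (Σ; ∃; _×_)
open import Data.Unit using (⊤)
open import Data.Empty using (⊥)
open import Relation.Unary using (Pred)
open import Relation.Binary.PropositionalEquality using (_≡_)

record Graph (V : Set) : Set₁ where
  field
    E      : V → V → Set
    sym    : ∀ {u v} → E u v → E v u
    irrefl : ∀ {v} → E v v → ⊥
open Graph public

-- Vertex sets (induced subgraphs are identified with vertex sets).
VSet : Set → Set₁
VSet V = Pred V 0ℓ

data WalkIn {V : Set} (G : Graph V) (S : VSet V) : V → V → Set where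
  here : ∀ {u} → S u → WalkIn G S u u
  step : ∀ {u w v} → S u → E G u w → WalkIn G S w v → WalkIn G S u v

Connected : {V : Set} → Graph V → VSet V → Set
Connected G S = ∀ u v → S u → S v → WalkIn G S u v

IsPath : {V : Set} → Graph V → List V → Set
IsPath G []            = ⊤
IsPath G (x ∷ [])      = ⊤
IsPath G (x ∷ y ∷ xs)  = E G x y × IsPath G (y ∷ xs)

IsCycle : {V : Set} → Graph V → V → List V → Set
IsCycle G x xs = (3 ≤ length (x ∷ xs)) × Unique (x ∷ xs) × IsPath G (x ∷ xs ++ [ x ])

Acyclic : {V : Set} → Graph V → Set
Acyclic G = ∀ x xs → IsCycle G x xs → ⊥

IsTree : {V : Set} → Graph V → Set
IsTree G = Connected G (λ _ → ⊤) × Acyclic G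

AtMost : {V : Set} → ℕ → VSet V → Set
AtMost {V} k S = Σ (List V) λ xs → length xs ≤ k × (∀ x → S x → x ∈ xs)

record TreeDecomposition {V : Set} (G : Graph V) : Set₁ where
  field
    k       : ℕ
    T       : Graph (Fin k)
    isTree  : IsTree T
    bag     : Fin k → VSet V
    cover   : ∀ v → ∃ λ t → bag t v
    edgeCov : ∀ u v → E G u v → ∃ λ t → bag t u × bag t v
    subtree : ∀ v → Connected T (λ t → bag t v)

TwAtMost : {V : Set} → Graph V → ℕ → Set₁
TwAtMost G w = Σ (TreeDecomposition G) λ D →
  ∀ t → AtMost (suc w) (TreeDecomposition.bag D t)

data Color : Set where
  red blue : Color

BlueV : {n : ℕ} → (Fin n → Color) → Set
BlueV {n} c = Σ (Fin n) λ v → c v ≡ blue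

NonPiercing : {n : ℕ} → Graph (Fin n) → List (VSet (Fin n)) → Set₁
NonPiercing G ℋ = (∀ H → H ∈ ℋ → Connected G H) ×
  (∀ H H' → H ∈ ℋ → H' ∈ ℋ → Connected G (λ v → H v × (H' v → ⊥)))

PrimalSupport : {n : ℕ} → Graph (Fin n) → (c : Fin n → Color) →
  List (VSet (Fin n)) → Graph (BlueV c) → Set₁
PrimalSupport G c ℋ Q = ∀ H → H ∈ ℋ → Connected Q (λ p → H (Data.Product.proj₁ p))

{-# OPTIONS --safe #-}
module Submission where

-- G is a clique of d hubs (red) joined to N + 1 pairwise non-adjacent blue vertices, so
-- tw(G) ≤ d. For each pair e of blue vertices, ℋ contains e together with a nonempty set A e
-- of hubs. Since hubs are adjacent to everything, removing one member of ℋ from another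
-- can only disconnect it if the pairs are disjoint and no hub survives; this never happens
-- when the A e form an antichain. Every support is then complete on the blue vertices, and a
-- complete graph on N + 1 vertices has treewidth N by the Helly property of subtrees. With
-- h = ⌊m/2⌋ and d = 2h, the middle layer of the subsets of [2h] accommodates
-- C(2h, h) ≥ 4^h / 2h pairs, which allows N² ≥ C(2h, h).

open import Defs
open import Data.Nat using (ℕ; _≤_; _*_; _^_; zero; suc; _+_; _<_; z≤n; s≤s; _≤?_; _<?_)
open import Data.Nat.DivMod using (_/_; m/n*n≤m)
open import Data.Nat.Properties hiding (≡-irrelevant; _≟_)
open import Data.Nat.Solver using (module +-*-Solver)
open import Data.Fin using (Fin; zero; suc; splitAt; _↑ˡ_; _↑ʳ_; inject≤)
open import Data.Fin.Properties using (any?; splitAt-↑ˡ; splitAt-↑ʳ; splitAt⁻¹-↑ˡ; splitAt⁻¹-↑ʳ; ↑ˡ-injective; inject≤-injective; injective⇒≤)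
import Data.Fin.Properties as Fin
open import Data.Bool using (Bool; true; false)
import Data.Bool.Properties as Bool
open import Data.List using (List; []; _∷_; [_]; _++_; length; tabulate; allFin)
import Data.List as List
open import Data.List.Properties using (length-tabulate)
open import Data.List.Membership.Propositional using (_∈_; _∉_)
open import Data.List.Membership.Propositional.Properties using (∈-tabulate⁺; ∈-tabulate⁻; ∈-allFin)
open import Data.List.Membership.DecPropositional using (_∈?_)
open import Data.List.Relation.Unary.Any as Any using (here; there)
open import Data.List.Relation.Unary.Any.Properties using (lookup-index)
open import Data.List.Relation.Unary.All as All using (All; []; _∷_)
open import Data.List.Relation.Unary.All.Properties using (¬Any⇒All¬)
open import Data.List.Relation.Unary.AllPairs using ([]; _∷_)
open import Data.List.Relation.Unary.Unique.Propositional using (Unique)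
open import Data.Product using (Σ; ∃; _×_; _,_; proj₁; proj₂)
import Data.Product as Product
open import Data.Sum using (_⊎_; inj₁; inj₂; [_,_]′)
import Data.Sum as Sum
open import Data.Unit using (⊤; tt)
open import Data.Empty using (⊥; ⊥-elim)
open import Function using (_∘_; case_of_)
open import Relation.Binary.Definitions using (DecidableEquality)
open import Relation.Binary.PropositionalEquality as ≡ using (_≡_; _≢_; refl; cong; subst)
open import Relation.Binary.PropositionalEquality.WithK using (≡-irrelevant)
open import Relation.Nullary using (¬_; yes; no; contradiction)
open import Relation.Nullary.Decidable using (_×-dec_; decidable-stable; ¬¬-excluded-middle)

-- Walks, simple paths and acyclic graphs

module _ {V : Set} {G : Graph V} where

  infixr 5 _⊙_

  _⊙_ : ∀ {S u w v} → WalkIn G S u w → WalkIn G S w v → WalkIn G S u v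
  here _      ⊙ q = q
  step Su e p ⊙ q = step Su e (p ⊙ q)

  walk-mono : ∀ {S R : VSet V} {u v} → (∀ {x} → S x → R x) → WalkIn G S u v → WalkIn G R u v
  walk-mono f (here Su)     = here (f Su)
  walk-mono f (step Su e p) = step (f Su) e (walk-mono f p)

  walk-start : ∀ {S u v} → WalkIn G S u v → S u
  walk-start (here Su)     = Su
  walk-start (step Su _ _) = Su

  walk-reverse : ∀ {S u v} → WalkIn G S u v → WalkIn G S v u
  walk-reverse (here Su)     = here Su
  walk-reverse (step Su e p) = walk-reverse p ⊙ step (walk-start p) (sym G e) (here Su)

  -- The set containing the vertices is kept apart, as an `All` over the list, so that one path
  -- yields walks in different sets, such as the complement of any vertex off the list.
  data SimplePath : V → V → List V → Set where
    [-]  : ∀ {u} → SimplePath u u [ u ]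
    cons : ∀ {u w v xs} → E G u w → u ∉ xs → SimplePath w v xs → SimplePath u v (u ∷ xs)

  suffix : ∀ {S : VSet V} {u v x xs} → SimplePath u v xs → All S xs → x ∈ xs →
           ∃ λ ys → SimplePath x v ys × All S ys
  suffix [-]            ss       (here refl) = _ , [-] , ss
  suffix (cons e u∉ p)  ss       (here refl) = _ , cons e u∉ p , ss
  suffix (cons _ _ p)   (_ ∷ ss) (there x∈)  = suffix p ss x∈

  simple⇒walk : ∀ {S u v xs} → SimplePath u v xs → All S xs → WalkIn G S u v
  simple⇒walk [-]          (s ∷ _)  = here s
  simple⇒walk (cons e _ p) (s ∷ ss) = step s e (simple⇒walk p ss)

  simple-unique : ∀ {u v xs} → SimplePath u v xs → Unique xs
  simple-unique [-]           = [] ∷ []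
  simple-unique (cons _ u∉ p) = ¬Any⇒All¬ _ u∉ ∷ simple-unique p

  extend-isPath : ∀ {g u v z xs} → E G g u → SimplePath u v xs → E G v z → IsPath G (g ∷ xs ++ [ z ])
  extend-isPath e [-]           e′ = e , e′ , tt
  extend-isPath e (cons e″ _ p) e′ = e , extend-isPath e″ p e′

  simple-length : ∀ {u v xs} → u ≢ v → SimplePath u v xs → 2 ≤ length xs
  simple-length u≢v [-]                     = contradiction refl u≢v
  simple-length u≢v (cons _ _ [-])          = s≤s (s≤s z≤n)
  simple-length u≢v (cons _ _ (cons _ _ _)) = s≤s (s≤s z≤n)

  module _ (_≟_ : DecidableEquality V) where

    shorten : ∀ {S u v} → WalkIn G S u v → ∃ λ xs → SimplePath u v xs × All S xs
    shorten (here Su) = _ , [-] , Su ∷ []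
    shorten {u = u} (step Su e w) with xs , p , ss ← shorten w with _∈?_ _≟_ u xs
    ... | yes u∈ = suffix p ss u∈
    ... | no  u∉ = _ , cons e u∉ p , Su ∷ ss

    -- The recursion settles the tail first: when the tail avoids `t` and the current vertex is `t`,
    -- this is its last visit and the next vertex is the exit. The start is arbitrary because tails
    -- start anywhere.
    last-exit : ∀ {S u v} t → t ≢ v → WalkIn G S u v →
                WalkIn G (λ x → S x × t ≢ x) u v ⊎
                ∃ λ t′ → E G t t′ × WalkIn G (λ x → S x × t ≢ x) t′ v
    last-exit t t≢v (here Su) = inj₁ (here (Su , t≢v))
    last-exit {u = u} t t≢v (step Su e p) with last-exit t t≢v p
    ... | inj₂ r = inj₂ r
    ... | inj₁ q with t ≟ u
    ...   | yes refl = inj₂ (_ , e , q)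
    ...   | no  t≢u  = inj₁ (step (Su , t≢u) e q)

    exit : ∀ {S t v} → t ≢ v → WalkIn G S t v →
           ∃ λ t′ → E G t t′ × WalkIn G (λ x → S x × t ≢ x) t′ v
    exit {t = t} t≢v p with last-exit t t≢v p
    ... | inj₁ q = contradiction refl (proj₂ (walk-start q))
    ... | inj₂ r = r

    module _ (acyclic : Acyclic G) where

      -- Otherwise a simple path from `x` to `y` away from `g`, closed up through `g`, would be a
      -- cycle.
      acyclic⇒cut : ∀ {g x y} → E G g x → E G g y → WalkIn G (g ≢_) x y → x ≡ y
      acyclic⇒cut {g} {x} {y} gx gy w with x ≟ y
      ... | yes x≡y = x≡y
      ... | no  x≢y with xs , p , ss ← shorten w =
        ⊥-elim (acyclic g xs
          ( s≤s (simple-length x≢y p)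
          , ss ∷ simple-unique p
          , extend-isPath gx p (sym G gy)))

      -- A connected R containing t and meeting S leaves t, for the last time, through a
      -- neighbour joined to s inside (R ∪ S) ∖ t; by the cut property this neighbour is t′.
      towards : ∀ {R S t t′ s x} → Connected G R → Connected G S →
                R t → ¬ S t → R x → S x → S s →
                E G t t′ → WalkIn G (t ≢_) t′ s → R t′
      towards {R} {S} {t} {t′} {s} {x} connR connS Rt ¬St Rx Sx Ss tt′ t′⇝s =
        subst R (acyclic⇒cut tt″ tt′ t″⇝t′) (proj₁ (walk-start t″⇝x))
        where
        S⇒≢ : ∀ {y} → S y → t ≢ y
        S⇒≢ Sy refl = ¬St Sy
        leave = exit (S⇒≢ Sx) (connR t x Rt Rx)
        t″    = proj₁ leave
        tt″   = proj₁ (proj₂ leave)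
        t″⇝x  = proj₂ (proj₂ leave)
        t″⇝t′ : WalkIn G (t ≢_) t″ t′
        t″⇝t′ = walk-mono proj₂ t″⇝x ⊙ walk-mono S⇒≢ (connS x s Sx Ss) ⊙ walk-reverse t′⇝s

-- The Helly property of subtrees

module _ {V I : Set} {T : Graph V} (_≟_ : DecidableEquality V) (isTree : IsTree T)
         (F : I → VSet V) (connected : ∀ i → Connected T (F i))
         (meet : ∀ i j → ∃ λ t → F i t × F j t) where

  private
    -- Follow the simple path from `t` to a vertex of `F i`. While the current vertex is outside
    -- `F i`, `towards` puts the next one into every `F j` of the list. Membership in `F i` is an
    -- arbitrary proposition, hence the double negation.
    gate : ∀ {t s ts} i is → SimplePath {G = T} t s ts → F i s → All (λ j → F j t) is →
           ¬ ¬ (∃ λ t′ → All (λ j → F j t′) (i ∷ is))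
    gate i is [-] Fis all ¬∃ = ¬∃ (_ , Fis ∷ all)
    gate {t} i is (cons e t∉ p) Fis all ¬∃ = ¬¬-excluded-middle λ where
      (yes Fit) → ¬∃ (_ , Fit ∷ all)
      (no ¬Fit) → gate i is p Fis
        (All.map (λ {j} Fjt → case meet i j of λ (x , Fix , Fjx) →
          towards _≟_ (proj₂ isTree) (connected j) (connected i) Fjt ¬Fit Fjx Fix Fis e
            (simple⇒walk p (¬Any⇒All¬ _ t∉))) all)
        ¬∃

  -- Induction on the list: from a vertex common to the tail, `gate` reaches one that lies in the
  -- new set too.
  helly : V → ∀ is → ¬ ¬ (∃ λ t → All (λ i → F i t) is)
  helly t₀ []       ¬∃ = ¬∃ (t₀ , [])
  helly t₀ (i ∷ is) ¬∃ = helly t₀ is λ (t , all) →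
    case meet i i of λ (s , Fis , _) →
    case shorten _≟_ (proj₁ isTree t s tt tt) of λ (_ , p , _) →
    gate i is p Fis all ¬∃

-- The nodes whose bags contain a given vertex form a subtree, and the subtrees of adjacent vertices
-- meet, so by `helly` some bag contains the whole clique.
clique≤tw : ∀ {W N t} {Q : Graph W} (f : Fin N → W) → (∀ {i j} → f i ≡ f j → i ≡ j) →
            (∀ i j → i ≢ j → E Q (f i) (f j)) → TwAtMost Q t → N ≤ suc t
clique≤tw {N = zero} f f-inj adj tw = z≤n
clique≤tw {N = suc N} {t} f f-inj adj (D , width) =
  -- The goal is decidable, which discharges the double negation of `helly`.
  decidable-stable (suc N ≤? suc t) λ ≰ →
    helly Fin._≟_ isTree (λ i x → bag x (f i)) (subtree ∘ f) meet (proj₁ (cover (f zero)))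
      (allFin (suc N)) λ (x , all) → ≰ (bound x (λ i → All.lookup all (∈-allFin i)))
  where
  open TreeDecomposition D
  meet : ∀ i j → ∃ λ x → bag x (f i) × bag x (f j)
  meet i j with i Fin.≟ j
  ... | yes refl = Product.map₂ (λ b → b , b) (cover (f i))
  ... | no  i≢j  = edgeCov (f i) (f j) (adj i j i≢j)
  bound : ∀ x → (∀ i → bag x (f i)) → suc N ≤ suc t
  bound x inBag with ys , len , ∈ys ← width x =
    ≤-trans (injective⇒≤ {f = λ i → Any.index (pos i)} pos-inj) len
    where
    pos : ∀ i → f i ∈ ys
    pos i = ∈ys (f i) (inBag i)
    pos-inj : ∀ {i j} → Any.index (pos i) ≡ Any.index (pos j) → i ≡ j
    pos-inj {i} {j} eq = f-inj (≡.trans (lookup-index (pos i))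
      (≡.trans (cong (List.lookup ys) eq) (≡.sym (lookup-index (pos j)))))

-- Stars are trees

star : ∀ n → Graph (Fin (suc n))
star n = record { E = Adj ; sym = λ {u} {v} → Adj-sym u v ; irrefl = λ {v} → Adj-irrefl v }
  where
  Adj : Fin (suc n) → Fin (suc n) → Set
  Adj zero    zero    = ⊥
  Adj zero    (suc _) = ⊤
  Adj (suc _) zero    = ⊤
  Adj (suc _) (suc _) = ⊥
  Adj-sym : ∀ u v → Adj u v → Adj v u
  Adj-sym zero    (suc _) _ = tt
  Adj-sym (suc _) zero    _ = tt
  Adj-irrefl : ∀ v → Adj v v → ⊥
  Adj-irrefl zero    ()
  Adj-irrefl (suc _) ()

star-isTree : ∀ n → IsTree (star n)
star-isTree n = conn , acyc
  where
  toCentre : ∀ u → WalkIn (star n) (λ _ → ⊤) u zero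
  toCentre zero    = here tt
  toCentre (suc _) = step tt tt (here tt)
  conn : Connected (star n) (λ _ → ⊤)
  conn u v _ _ = toCentre u ⊙ walk-reverse (toCentre v)
  acyc : Acyclic (star n)
  acyc x []       (s≤s () , _)
  acyc x (y ∷ []) (s≤s (s≤s ()) , _)
  -- A leaf is adjacent to the centre only, so a cycle either visits the centre twice among its
  -- first four vertices or contains an edge between leaves.
  acyc zero    (suc _ ∷ zero ∷ _)         (_ , (_ ∷ x≢z ∷ _) ∷ _ , _) = x≢z refl
  acyc (suc _) (zero ∷ suc _ ∷ [])        (_ , _ , _ , _ , () , _)
  acyc (suc _) (zero ∷ suc _ ∷ zero ∷ _)  (_ , _ ∷ (_ ∷ y≢w ∷ _) ∷ _ , _) = y≢w refl
  acyc (suc _) (zero ∷ suc _ ∷ suc _ ∷ _) (_ , _ , _ , _ , () , _)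
  acyc zero    (zero ∷ _ ∷ _)             (_ , _ , () , _)
  acyc (suc _) (suc _ ∷ _ ∷ _)            (_ , _ , () , _)
  acyc (suc _) (zero ∷ zero ∷ _)          (_ , _ , _ , () , _)
  acyc zero    (suc _ ∷ suc _ ∷ _)        (_ , _ , _ , () , _)

-- Edges of the complete graph

-- The binomial coefficient n choose 2, as a sum that lets `splitAt` separate the edges at vertex
-- zero from the rest.
pairs : ℕ → ℕ
pairs zero    = 0
pairs (suc n) = n + pairs n

ends : ∀ n → Fin (pairs n) → Fin n × Fin n
ends (suc n) e = [ (λ i → zero , suc i) , Product.map suc suc ∘ ends n ]′ (splitAt n e)

ends-surjective : ∀ n i j → i ≢ j → ∃ λ e → ends n e ≡ (i , j) ⊎ ends n e ≡ (j , i)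
ends-surjective (suc n) zero    zero    i≢j = contradiction refl i≢j
ends-surjective (suc n) zero    (suc j) i≢j =
  j ↑ˡ pairs n , inj₁ (cong [ _ , _ ]′ (splitAt-↑ˡ n j (pairs n)))
ends-surjective (suc n) (suc i) zero    i≢j =
  i ↑ˡ pairs n , inj₂ (cong [ _ , _ ]′ (splitAt-↑ˡ n i (pairs n)))
ends-surjective (suc n) (suc i) (suc j) i≢j
  with e , r ← ends-surjective n i j (i≢j ∘ cong suc) =
  n ↑ʳ e , Sum.map lift lift r
  where
  lift : ∀ {p} → ends n e ≡ p → ends (suc n) (n ↑ʳ e) ≡ Product.map suc suc p
  lift eq = ≡.trans (cong [ _ , _ ]′ (splitAt-↑ʳ n (pairs n) e)) (cong (Product.map suc suc) eq)

_∈ends_ : ∀ {n} → Fin n → Fin (pairs n) → Set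
i ∈ends e = i ≡ proj₁ (ends _ e) ⊎ i ≡ proj₂ (ends _ e)

Disjoint : ∀ n → Fin (pairs n) → Fin (pairs n) → Set
Disjoint n e f = ∀ (i : Fin n) → i ∈ends e → ¬ (i ∈ends f)

-- The graph of hubs and terminals and its supports

module Construction {N d : ℕ} (A : Fin (pairs (suc N)) → Fin d → Bool)
  (nonempty : ∀ e → ∃ λ x → A e x ≡ true)
  (separated : ∀ e f → Disjoint (suc N) e f → ∃ λ x → A e x ≡ true × A f x ≡ false) where

  private
    n = suc N

  -- Adjacency, colours, members and bags are defined on this sum and pulled back along `view`, so
  -- that proofs can match on the two kinds of vertex.
  Vertex : Set
  Vertex = Fin n ⊎ Fin d

  view : Fin (n + d) → Vertex
  view = splitAt n

  terminal : Fin n → Fin (n + d)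
  terminal i = i ↑ˡ d

  hub : Fin d → Fin (n + d)
  hub x = n ↑ʳ x

  Adj : Vertex → Vertex → Set
  Adj (inj₁ _) (inj₁ _) = ⊥
  Adj (inj₁ _) (inj₂ _) = ⊤
  Adj (inj₂ _) (inj₁ _) = ⊤
  Adj (inj₂ x) (inj₂ y) = x ≢ y

  Adj-sym : ∀ u v → Adj u v → Adj v u
  Adj-sym (inj₁ _) (inj₂ _) _   = tt
  Adj-sym (inj₂ _) (inj₁ _) _   = tt
  Adj-sym (inj₂ _) (inj₂ _) x≢y = x≢y ∘ ≡.sym

  Adj-irrefl : ∀ v → ¬ Adj v v
  Adj-irrefl (inj₂ _) x≢x = x≢x refl

  G : Graph (Fin (n + d))
  G = record
    { E      = λ u v → Adj (view u) (view v)
    ; sym    = λ {u} {v} → Adj-sym (view u) (view v)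
    ; irrefl = λ {v} → Adj-irrefl (view v)
    }

  colour : Vertex → Color
  colour (inj₁ _) = blue
  colour (inj₂ _) = red

  c : Fin (n + d) → Color
  c = colour ∘ view

  Member : Fin (pairs n) → Vertex → Set
  Member e (inj₁ i) = i ∈ends e
  Member e (inj₂ x) = A e x ≡ true

  H : Fin (pairs n) → VSet (Fin (n + d))
  H e = Member e ∘ view

  ℋ : List (VSet (Fin (n + d)))
  ℋ = tabulate H

  -- Each node of the star, the centre included, holds one terminal and all hubs: d + 1 vertices,
  -- hence width d.
  Bag : Fin n → Vertex → Set
  Bag t (inj₁ i) = t ≡ i
  Bag t (inj₂ _) = ⊤

  decomposition : TreeDecomposition G
  decomposition = record
    { k       = n
    ; T       = star N
    ; isTree  = star-isTree N
    ; bag     = λ t v → Bag t (view v)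
    ; cover   = λ v → cover (view v)
    ; edgeCov = λ u v → edgeCov (view u) (view v)
    ; subtree = λ v → subtree (view v)
    }
    where
    cover : ∀ v → ∃ λ t → Bag t v
    cover (inj₁ i) = i , refl
    cover (inj₂ _) = zero , tt
    edgeCov : ∀ u v → Adj u v → ∃ λ t → Bag t u × Bag t v
    edgeCov (inj₁ i) (inj₂ _) _ = i , refl , tt
    edgeCov (inj₂ _) (inj₁ i) _ = i , tt , refl
    edgeCov (inj₂ _) (inj₂ _) _ = zero , tt , tt
    subtree : ∀ v → Connected (star N) (λ t → Bag t v)
    subtree (inj₁ i) t u refl refl = here refl
    subtree (inj₂ _) = proj₁ (star-isTree N)

  tw-G : ∀ {m} → d ≤ m → TwAtMost G m
  tw-G d≤m = decomposition , λ t →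
    terminal t ∷ tabulate hub ,
    s≤s (≤-trans (≤-reflexive (length-tabulate hub)) d≤m) ,
    λ v → inBag t v
    where
    inBag : ∀ t v → Bag t (view v) → v ∈ terminal t ∷ tabulate hub
    inBag t v b with view v in eq
    ... | inj₁ i = here (≡.trans (≡.sym (splitAt⁻¹-↑ˡ eq)) (cong terminal (≡.sym b)))
    ... | inj₂ x = there (subst (_∈ tabulate hub) (splitAt⁻¹-↑ʳ eq) (∈-tabulate⁺ x))

  hub-view : ∀ x → view (hub x) ≡ inj₂ x
  hub-view = splitAt-↑ʳ n d

  terminal-view : ∀ i → view (terminal i) ≡ inj₁ i
  terminal-view i = splitAt-↑ˡ n i d

  hub⇒connected : ∀ {S} x → S (hub x) → Connected G S
  hub⇒connected {S} x Sx u v Su Sv = toHub u Su ⊙ walk-reverse (toHub v Sv)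
    where
    adj : ∀ w → (∀ y → w ≡ inj₂ y → y ≢ x) → Adj w (inj₂ x)
    adj (inj₁ _) _ = tt
    adj (inj₂ y) f = f y refl
    toHub : ∀ w → S w → WalkIn G S w (hub x)
    toHub w Sw with w Fin.≟ hub x
    ... | yes refl = here Sx
    ... | no  w≢x  = step Sw
      (subst (Adj (view w)) (≡.sym (hub-view x))
        (adj (view w) λ y eq y≡x → w≢x (≡.trans (≡.sym (splitAt⁻¹-↑ʳ eq)) (cong hub y≡x))))
      (here Sx)

  H-connected : ∀ e → Connected G (H e)
  H-connected e with x , Aex ← nonempty e =
    hub⇒connected x (subst (Member e) (≡.sym (hub-view x)) Aex)

  -- If no hub survives the removal of H f, then e and f share an endpoint, so at most one
  -- vertex remains.
  H∖H-connected : ∀ e f → Connected G (λ v → H e v × ¬ H f v)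
  H∖H-connected e f with any? (λ x → (A e x Bool.≟ true) ×-dec (A f x Bool.≟ false))
  ... | yes (x , Aex , Afx) = hub⇒connected x
    ( subst (Member e) (≡.sym (hub-view x)) Aex
    , λ m → case ≡.trans (≡.sym Afx) (subst (Member f) (hub-view x) m) of λ () )
  ... | no noHub = λ u v Su Sv → subst (WalkIn G _ u) (unique u v Su Sv) (here Su)
    where
    terminals : ∀ w → Member e w → ¬ Member f w → ∃ λ (i : Fin n) → w ≡ inj₁ i × i ∈ends e × ¬ (i ∈ends f)
    terminals (inj₁ i) ie ¬if = i , refl , ie , ¬if
    terminals (inj₂ x) xe ¬xf = contradiction (x , xe , Bool.¬-not ¬xf) noHub
    same : ∀ (i j : Fin n) → i ∈ends e → ¬ (i ∈ends f) → j ∈ends e → ¬ (j ∈ends f) → i ≡ j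
    same i j ie ¬if je ¬jf with i Fin.≟ j
    ... | yes i≡j = i≡j
    ... | no  i≢j = contradiction (separated e f disjoint) noHub
      where
      third : ∀ {k : Fin n} → i ∈ends e → j ∈ends e → k ∈ends e → k ≡ i ⊎ k ≡ j
      third (inj₁ p) (inj₁ q) _        = contradiction (≡.trans p (≡.sym q)) i≢j
      third (inj₂ p) (inj₂ q) _        = contradiction (≡.trans p (≡.sym q)) i≢j
      third (inj₁ p) (inj₂ q) (inj₁ r) = inj₁ (≡.trans r (≡.sym p))
      third (inj₁ p) (inj₂ q) (inj₂ r) = inj₂ (≡.trans r (≡.sym q))
      third (inj₂ p) (inj₁ q) (inj₂ r) = inj₁ (≡.trans r (≡.sym p))
      third (inj₂ p) (inj₁ q) (inj₁ r) = inj₂ (≡.trans r (≡.sym q))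
      disjoint : Disjoint n e f
      disjoint k ke kf with third ie je ke
      ... | inj₁ refl = ¬if kf
      ... | inj₂ refl = ¬jf kf
    unique : ∀ u v → H e u × ¬ H f u → H e v × ¬ H f v → u ≡ v
    unique u v (ue , ¬uf) (ve , ¬vf)
      with i , iu , ie , ¬if ← terminals (view u) ue ¬uf
         | j , jv , je , ¬jf ← terminals (view v) ve ¬vf =
      ≡.trans (≡.sym (splitAt⁻¹-↑ˡ iu))
        (≡.trans (cong terminal (same i j ie ¬if je ¬jf)) (splitAt⁻¹-↑ˡ jv))

  nonPiercing : NonPiercing G ℋ
  nonPiercing =
    (λ H₁ ∈₁ → case ∈-tabulate⁻ ∈₁ of λ { (e , refl) → H-connected e }) ,
    (λ H₁ H₂ ∈₁ ∈₂ → case ∈-tabulate⁻ ∈₁ of λ { (e , refl) →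
      case ∈-tabulate⁻ ∈₂ of λ { (f , refl) → H∖H-connected e f } })

  blueVertex : Fin n → BlueV c
  blueVertex i = terminal i , cong colour (terminal-view i)

  blueVertex-injective : ∀ {i j} → blueVertex i ≡ blueVertex j → i ≡ j
  blueVertex-injective {i} {j} eq = ↑ˡ-injective d i j (cong proj₁ eq)

  blueMember : ∀ {e} w → Member e w → colour w ≡ blue → ∃ λ (i : Fin n) → w ≡ inj₁ i × i ∈ends e
  blueMember (inj₁ i) i∈ _ = i , refl , i∈

  H∩blue : ∀ e (p : BlueV c) → H e (proj₁ p) → ∃ λ (i : Fin n) → p ≡ blueVertex i × i ∈ends e
  H∩blue e (v , cv) m with i , v≡i , i∈ ← blueMember {e} (view v) m cv
    -- Elements of `BlueV c` carry a proof of their colour; uniqueness of identity proofs identifies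
    -- the two.
    with refl ← splitAt⁻¹-↑ˡ {n} {d} {v} v≡i = i , cong (_ ,_) (≡-irrelevant cv _) , i∈

  -- The blue part of `H e` is just the pair i, j. A walk in it from i to j must take a first step,
  -- and irreflexivity sends that step to j.
  support-complete : ∀ {Q} → PrimalSupport G c ℋ Q → ∀ i j → i ≢ j →
                     E Q (blueVertex i) (blueVertex j)
  support-complete {Q} support i j i≢j with e , r ← ends-surjective n i j i≢j =
    firstStep refl (support (H e) (∈-tabulate⁺ e) (blueVertex i) (blueVertex j)
      (member (proj₁ ij)) (member (proj₁ (proj₂ ij))))
    where
    endpoints : ∀ {p} → p ≡ (i , j) ⊎ p ≡ (j , i) →
      (i ≡ proj₁ p ⊎ i ≡ proj₂ p) × (j ≡ proj₁ p ⊎ j ≡ proj₂ p) ×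
      (∀ {k} → k ≡ proj₁ p ⊎ k ≡ proj₂ p → k ≡ i ⊎ k ≡ j)
    endpoints (inj₁ refl) = inj₁ refl , inj₂ refl , λ k → k
    endpoints (inj₂ refl) = inj₂ refl , inj₁ refl , Sum.swap
    ij = endpoints r
    member : ∀ {k : Fin n} → k ∈ends e → H e (terminal k)
    member {k} k∈ = subst (Member e) (≡.sym (terminal-view k)) k∈
    -- The endpoint is a variable with an equation, so that matching `here` need not unify two
    -- values of `blueVertex`.
    firstStep : ∀ {p} → p ≡ blueVertex j → WalkIn Q (λ q → H e (proj₁ q)) (blueVertex i) p →
                E Q (blueVertex i) (blueVertex j)
    firstStep eq (here _) = contradiction (blueVertex-injective eq) i≢j
    firstStep eq (step {w = q} _ iq w) with k , q≡k , k∈ ← H∩blue e q (walk-start w)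
      with proj₂ (proj₂ ij) k∈
    ... | inj₁ refl = ⊥-elim (irrefl Q (subst (E Q (blueVertex i)) q≡k iq))
    ... | inj₂ refl = subst (E Q (blueVertex i)) q≡k iq

  tw-support : ∀ {Q t} → PrimalSupport G c ℋ Q → TwAtMost Q t → N ≤ t
  tw-support support tw =
    ≤-pred (clique≤tw blueVertex blueVertex-injective (support-complete support) tw)

-- Central binomial coefficients and the middle layer

binom : ℕ → ℕ → ℕ
binom n       zero    = 1
binom zero    (suc k) = 0
binom (suc n) (suc k) = binom n k + binom n (suc k)

-- The absorption identity, by Pascal's rule; it compares neighbouring coefficients without
-- division.
binom-absorb : ∀ n k → suc k * binom (suc n) (suc k) ≡ suc n * binom n k
binom-absorb zero    zero    = refl
binom-absorb zero    (suc k) = *-zeroʳ (suc (suc k))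
binom-absorb (suc n) zero    =
  ≡.trans (cong (λ z → 1 * (1 + z)) (≡.trans (≡.sym (*-identityˡ _)) (binom-absorb n 0)))
    (solve 1 (λ n → con 1 :* (con 1 :+ (con 1 :+ n) :* con 1) := (con 2 :+ n) :* con 1) refl n)
  where open +-*-Solver
binom-absorb (suc n) (suc k) = begin
  suc (suc k) * (binom (suc n) (suc k) + binom (suc n) (suc (suc k)))
    ≡⟨ solve 3 (λ k a b → (con 2 :+ k) :* (a :+ b) := (con 1 :+ k) :* a :+ a :+ (con 2 :+ k) :* b)
         refl k (binom (suc n) (suc k)) (binom (suc n) (suc (suc k))) ⟩
  suc k * binom (suc n) (suc k) + binom (suc n) (suc k) + suc (suc k) * binom (suc n) (suc (suc k))
    ≡⟨ ≡.cong₂ (λ x y → x + binom (suc n) (suc k) + y) (binom-absorb n k) (binom-absorb n (suc k)) ⟩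
  suc n * binom n k + (binom n k + binom n (suc k)) + suc n * binom n (suc k)
    ≡⟨ solve 3 (λ n a b → (con 1 :+ n) :* a :+ (a :+ b) :+ (con 1 :+ n) :* b
         := (con 2 :+ n) :* (a :+ b)) refl n (binom n k) (binom n (suc k)) ⟩
  suc (suc n) * (binom n k + binom n (suc k)) ∎
  where
  open ≡.≡-Reasoning
  open +-*-Solver

central : ℕ → ℕ
central h = binom (h * 2) h

central-step : ∀ h → suc h * central (suc h) ≡ 2 * (suc (h * 2) * central h)
central-step h = begin
  suc h * central (suc h)                     ≡⟨ binom-absorb (suc (h * 2)) h ⟩
  suc (suc (h * 2)) * binom (suc (h * 2)) h   ≡⟨ solve 2 (λ h b → (con 2 :+ h :* con 2) :* b := con 2 :* ((con 1 :+ h) :* b)) refl h (binom (suc (h * 2)) h) ⟩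
  2 * (suc h * binom (suc (h * 2)) h)         ≡⟨ cong (2 *_) below-middle ⟩
  2 * (suc (h * 2) * central h)               ∎
  where
  open ≡.≡-Reasoning
  open +-*-Solver
  -- Expanding `suc h * central (suc h)` by absorption and by Pascal's rule and cancelling one
  -- summand equates the two middle coefficients of row 2h + 1, up to the factor h + 1. Absorption
  -- then evaluates the second.
  below-middle : suc h * binom (suc (h * 2)) h ≡ suc (h * 2) * central h
  below-middle = ≡.trans
    (+-cancelˡ-≡ (suc h * binom (suc (h * 2)) h) _ _ (begin
      suc h * binom (suc (h * 2)) h + suc h * binom (suc (h * 2)) h
        ≡⟨ solve 2 (λ h b → (con 1 :+ h) :* b :+ (con 1 :+ h) :* b := (con 2 :+ h :* con 2) :* b)
             refl h (binom (suc (h * 2)) h) ⟩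
      suc (suc (h * 2)) * binom (suc (h * 2)) h
        ≡⟨ binom-absorb (suc (h * 2)) h ⟨
      suc h * central (suc h)
        ≡⟨ *-distribˡ-+ (suc h) (binom (suc (h * 2)) h) (binom (suc (h * 2)) (suc h)) ⟩
      suc h * binom (suc (h * 2)) h + suc h * binom (suc (h * 2)) (suc h) ∎))
    (binom-absorb (h * 2) h)

-- The shift starts the induction at 4 = 2 * 2. From h to h + 1 the quantity `h * 2 * central h`
-- grows by the factor 4(2h + 1)/(2h), which is at least 4.
central-lower : ∀ h → 2 ^ suc h * 2 ^ suc h ≤ suc h * 2 * central (suc h)
central-lower zero    = ≤-refl
central-lower (suc h) = begin
  2 ^ suc (suc h) * 2 ^ suc (suc h)
    ≡⟨ solve 1 (λ x → (con 2 :* x) :* (con 2 :* x) := con 4 :* (x :* x)) refl (2 ^ suc h) ⟩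
  4 * (2 ^ suc h * 2 ^ suc h)
    ≤⟨ *-monoʳ-≤ 4 (central-lower h) ⟩
  4 * (suc h * 2 * central (suc h))
    ≤⟨ *-monoʳ-≤ 4 (*-monoˡ-≤ (central (suc h)) (n≤1+n (suc h * 2))) ⟩
  4 * (suc (suc h * 2) * central (suc h))
    ≡⟨ *-assoc 2 2 (suc (suc h * 2) * central (suc h)) ⟩
  2 * (2 * (suc (suc h * 2) * central (suc h)))
    ≡⟨ cong (2 *_) (central-step (suc h)) ⟨
  2 * (suc (suc h) * central (suc (suc h)))
    ≡⟨ solve 2 (λ h b → con 2 :* (h :* b) := h :* con 2 :* b) refl (suc (suc h)) (central (suc (suc h))) ⟩
  suc (suc h) * 2 * central (suc (suc h)) ∎
  where
  open ≤-Reasoning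
  open +-*-Solver

central-mono : ∀ h → central h ≤ central (suc h)
central-mono h = ≤-trans (m≤m+n (central h) (binom (h * 2) (suc h)))
  (m≤n+m (binom (suc (h * 2)) (suc h)) (binom (suc (h * 2)) h))

6≤central : ∀ h → 6 ≤ central (suc (suc h))
6≤central zero    = ≤-refl
6≤central (suc h) = ≤-trans (6≤central h) (central-mono (suc (suc h)))

-- The sets of size k, in the order that Pascal's recursion gives.
layer : ∀ n k → Fin (binom n k) → Fin n → Bool
layer (suc n) zero    x _       = false
layer (suc n) (suc k) x zero    = [ (λ _ → true) , (λ _ → false) ]′ (splitAt (binom n k) x)
layer (suc n) (suc k) x (suc i) = [ (λ y → layer n k y i) , (λ y → layer n (suc k) y i) ]′ (splitAt (binom n k) x)

_⊈_ : ∀ {n} → (Fin n → Bool) → (Fin n → Bool) → Set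
s ⊈ t = ∃ λ i → s i ≡ true × t i ≡ false

-- Compare the sets at element zero. If only the larger one has it, it is the witness; in all other
-- cases the remainders still differ in size the same way.
layer-larger : ∀ n k l x y → l < k → layer n k x ⊈ layer n l y
layer-larger zero    (suc k) l       () y l<k
layer-larger (suc n) (suc k) zero    x  y l<k with splitAt (binom n k) x in eq
... | inj₁ x′ = zero , cong [ _ , _ ]′ eq , refl
... | inj₂ x′ with i , p , q ← layer-larger n (suc k) 0 x′ zero l<k =
  suc i , ≡.trans (cong [ _ , _ ]′ eq) p , refl
layer-larger (suc n) (suc k) (suc l) x y (s≤s l<k) with splitAt (binom n k) x in eqx | splitAt (binom n l) y in eqy
... | inj₁ x′ | inj₂ y′ = zero , cong [ _ , _ ]′ eqx , cong [ _ , _ ]′ eqy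
... | inj₁ x′ | inj₁ y′ with i , p , q ← layer-larger n k l x′ y′ l<k =
  suc i , ≡.trans (cong [ _ , _ ]′ eqx) p , ≡.trans (cong [ _ , _ ]′ eqy) q
... | inj₂ x′ | inj₁ y′ with i , p , q ← layer-larger n (suc k) l x′ y′ (m≤n⇒m≤1+n l<k) =
  suc i , ≡.trans (cong [ _ , _ ]′ eqx) p , ≡.trans (cong [ _ , _ ]′ eqy) q
... | inj₂ x′ | inj₂ y′ with i , p , q ← layer-larger n (suc k) (suc l) x′ y′ (s≤s l<k) =
  suc i , ≡.trans (cong [ _ , _ ]′ eqx) p , ≡.trans (cong [ _ , _ ]′ eqy) q

-- Only when `y` alone contains element zero do the remainders differ in size, and then
-- `layer-larger` applies.
layer-antichain : ∀ n k x y → x ≢ y → layer n k x ⊈ layer n k y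
layer-antichain n       zero    zero zero x≢y = contradiction refl x≢y
layer-antichain (suc n) (suc k) x y x≢y with splitAt (binom n k) x in eqx | splitAt (binom n k) y in eqy
... | inj₁ x′ | inj₂ y′ = zero , cong [ _ , _ ]′ eqx , cong [ _ , _ ]′ eqy
... | inj₁ x′ | inj₁ y′ with i , p , q ← layer-antichain n k x′ y′
      (λ { refl → x≢y (≡.trans (≡.sym (splitAt⁻¹-↑ˡ eqx)) (splitAt⁻¹-↑ˡ eqy)) }) =
  suc i , ≡.trans (cong [ _ , _ ]′ eqx) p , ≡.trans (cong [ _ , _ ]′ eqy) q
... | inj₂ x′ | inj₁ y′ with i , p , q ← layer-larger n (suc k) k x′ y′ ≤-refl =
  suc i , ≡.trans (cong [ _ , _ ]′ eqx) p , ≡.trans (cong [ _ , _ ]′ eqy) q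
... | inj₂ x′ | inj₂ y′ with i , p , q ← layer-antichain n (suc k) x′ y′
      (λ { refl → x≢y (≡.trans (≡.sym (splitAt⁻¹-↑ʳ {binom n k} eqx)) (splitAt⁻¹-↑ʳ eqy)) }) =
  suc i , ≡.trans (cong [ _ , _ ]′ eqx) p , ≡.trans (cong [ _ , _ ]′ eqy) q

-- Triangular numbers against squares

pairs-bracket : ∀ C → ∃ λ p → pairs (suc p) ≤ C × C < pairs (suc (suc p))
pairs-bracket zero = 0 , z≤n , s≤s z≤n
pairs-bracket (suc C) with p , lo , hi ← pairs-bracket C with suc C <? pairs (suc (suc p))
... | yes lt = p , m≤n⇒m≤1+n lo , lt
... | no ¬lt = suc p , ≮⇒≥ ¬lt , s≤s (≤-trans hi (m≤n+m _ (suc p)))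

-- With p = 3 + q this bounds p + 2 choose 2 by p² + 1. There is equality at p = 3 and failure at p
-- = 2, whence the offset.
pairs≤square : ∀ q → pairs (5 + q) ≤ suc ((3 + q) * (3 + q))
pairs≤square zero    = ≤-refl
pairs≤square (suc q) = begin
  5 + q + pairs (5 + q)               ≤⟨ +-monoʳ-≤ (5 + q) (pairs≤square q) ⟩
  -- The squares differ by 7 + 2q = (5 + q) + (2 + q).
  5 + q + suc ((3 + q) * (3 + q))     ≤⟨ m≤m+n _ (2 + q) ⟩
  5 + q + suc ((3 + q) * (3 + q)) + (2 + q)
    ≡⟨ solve 1 (λ q → con 5 :+ q :+ (con 1 :+ (con 3 :+ q) :* (con 3 :+ q)) :+ (con 2 :+ q)
         := con 1 :+ (con 4 :+ q) :* (con 4 :+ q)) refl q ⟩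
  suc ((4 + q) * (4 + q))             ∎
  where
  open ≤-Reasoning
  open +-*-Solver

-- Take the p of `pairs-bracket`. Since 4 choose 2 is 6, the hypothesis forces p to be at least 3,
-- and the strict upper bound absorbs the 1 in `pairs≤square`.
pairs-root : ∀ C → 6 ≤ C → ∃ λ p → pairs (suc p) ≤ C × C ≤ p * p
pairs-root C 6≤C with pairs-bracket C
... | 0 , lo , hi = contradiction (≤-trans hi (s≤s z≤n)) (≤⇒≯ 6≤C)
... | 1 , lo , hi = contradiction (≤-trans hi (s≤s (s≤s (s≤s z≤n)))) (≤⇒≯ 6≤C)
... | 2 , lo , hi = contradiction hi (≤⇒≯ 6≤C)
... | suc (suc (suc q)) , lo , hi = 3 + q , lo , ≤-pred (≤-trans hi (pairs≤square q))

ends-meet : (e f : Fin (pairs 3)) → ¬ Disjoint 3 e f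
ends-meet zero             zero             dis = dis zero (inj₁ refl) (inj₁ refl)
ends-meet zero             (suc zero)       dis = dis zero (inj₁ refl) (inj₁ refl)
ends-meet zero             (suc (suc zero)) dis = dis (suc zero) (inj₂ refl) (inj₁ refl)
ends-meet (suc zero)       zero             dis = dis zero (inj₁ refl) (inj₁ refl)
ends-meet (suc zero)       (suc zero)       dis = dis zero (inj₁ refl) (inj₁ refl)
ends-meet (suc zero)       (suc (suc zero)) dis = dis (suc (suc zero)) (inj₂ refl) (inj₂ refl)
ends-meet (suc (suc zero)) zero             dis = dis (suc zero) (inj₁ refl) (inj₂ refl)
ends-meet (suc (suc zero)) (suc zero)       dis = dis (suc (suc zero)) (inj₂ refl) (inj₂ refl)
ends-meet (suc (suc zero)) (suc (suc zero)) dis = dis (suc zero) (inj₁ refl) (inj₁ refl)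

-- The inequality is squared to stay within the naturals, and it is asserted for every t that bounds
-- the treewidth of Q.
theorem4 : (m : ℕ) → 1 ≤ m →
    Σ ℕ λ n → Σ (Graph (Fin n)) λ G → Σ (Fin n → Color) λ c →
    Σ (List (VSet (Fin n))) λ ℋ →
    TwAtMost G m × NonPiercing G ℋ ×
    ((Q : Graph (BlueV c)) → PrimalSupport G c ℋ Q →
    (t : ℕ) → TwAtMost Q t → 2 ^ (m / 2) * 2 ^ (m / 2) ≤ t * t * m)
theorem4 m 1≤m = byHalf (m / 2) (m/n*n≤m m 2)
  where
  -- With `m / 2` replaced by a variable, cases on h are possible; `byHalf` retains only 2h ≤ m.
  Claim : ℕ → Set₁
  Claim h = Σ ℕ λ n → Σ (Graph (Fin n)) λ G → Σ (Fin n → Color) λ c →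
    Σ (List (VSet (Fin n))) λ ℋ → TwAtMost G m × NonPiercing G ℋ ×
    ((Q : Graph (BlueV c)) → PrimalSupport G c ℋ Q →
    (t : ℕ) → TwAtMost Q t → 2 ^ h * 2 ^ h ≤ t * t * m)

  -- A triangle has no two disjoint edges, so one hub suffices.
  triangle : ∀ h → 2 ^ h * 2 ^ h ≤ 4 → Claim h
  triangle h small = _ , G , c , ℋ , tw-G 1≤m , nonPiercing , λ Q support t tw →
    let 2≤t = tw-support support tw in
    ≤-trans small (*-mono-≤ (*-mono-≤ 2≤t 2≤t) 1≤m)
    where
    open Construction {2} {1} (λ _ _ → true) (λ _ → zero , refl)
      (λ e f dis → ⊥-elim (ends-meet e f dis))

  byHalf : ∀ h → h * 2 ≤ m → Claim h
  -- For h ≤ 1 the middle layer has at most two sets, too few for `pairs-root`, but 4^h ≤ 4 is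
  -- within reach of width two.
  byHalf 0 _ = triangle 0 (s≤s z≤n)
  byHalf 1 _ = triangle 1 ≤-refl
  byHalf h@(suc (suc h′)) 2h≤m with p , pairs≤C , C≤p² ← pairs-root (central h) (6≤central h′) =
    _ , G , c , ℋ , tw-G 2h≤m , nonPiercing , λ Q support t tw →
    let p≤t = tw-support support tw
        open ≤-Reasoning in
    begin
      2 ^ h * 2 ^ h      ≤⟨ central-lower (suc h′) ⟩
      h * 2 * central h  ≤⟨ *-mono-≤ 2h≤m (≤-trans C≤p² (*-mono-≤ p≤t p≤t)) ⟩
      m * (t * t)        ≡⟨ *-comm m (t * t) ⟩
      t * t * m          ∎
    where
    A : Fin (pairs (suc p)) → Fin (h * 2) → Bool
    A e = layer (h * 2) h (inject≤ e pairs≤C)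
    open Construction A
      -- Comparison with the empty set, the only set of size 0, yields an element.
      (λ e → Product.map₂ proj₁ (layer-larger (h * 2) h 0 (inject≤ e pairs≤C) zero (s≤s z≤n)))
      -- Disjoint pairs are distinct, since a pair shares its first endpoint with itself.
      (λ e f dis → layer-antichain (h * 2) h _ _
        (λ eq → dis _ (inj₁ refl)
          (inj₁ (cong (proj₁ ∘ ends (suc p)) (inject≤-injective pairs≤C pairs≤C e f eq)))))
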